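{- Let $G$ be a topological group, let $\mathfrak S$ be an I-finite $G$-subgroup system and let $A$ be a discrete $G$-module. The following data define a cohomological and stable RIC-functor $A_*=\mathrm H^0_{\mathfrak S}(A):\mathfrak S\to\mathsf{Ab}$: $A_*(H)=A^H$ for $H\in\mathfrak S_{\mathrm b}$; $\mathrm{res}_{I,H}:A^H\to A^I$ the canonical inclusion for $H\in\mathfrak S_{\mathrm b}$, $I\in\mathfrak S_{\mathrm r}(H)$; $\mathrm{ind}_{H,I}:A^I\to A^H$, $a\mapsto\sum_{h\in T}ha$, for $H\in\mathfrak S_{\mathrm b}$, $I\in\mathfrak S_{\mathrm i}(H)$ and an arbitrary left transversal $T$ of $I$ in $H$; $\mathrm{con}_{g,H}:A^H\to A^{{}^gH}$, $a\mapsto ga$, for $H\in\mathfrak S_{\mathrm b}$, $g\in G$. Moreover, if $\mathfrak M$ is an I-finite $G$-Mackey system, then $\mathrm H^0_{\mathfrak M}(A):\mathfrak M\to\mathsf{Ab}$ is a cohomological Mackey functor.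
   Context: ${}^gH=gHg^{ -1}$, $H^g=g^{ -1}Hg$. A $G$-subgroup system $\mathfrak S=(\mathfrak S_{\mathrm b},\mathfrak S_{\mathrm r},\mathfrak S_{\mathrm i})$ consists of a non-empty set $\mathfrak S_{\mathrm b}$ of subgroups of $G$ closed under conjugation and, for each $H\in\mathfrak S_{\mathrm b}$ and $\star\in\{\mathrm r,\mathrm i\}$, a set $\mathfrak S_\star(H)\subseteq\{I\in\mathfrak S_{\mathrm b}:I\le H\}$ with $H\in\mathfrak S_\star(H)$; $I\in\mathfrak S_\star(H)\Rightarrow\mathfrak S_\star(I)\subseteq\mathfrak S_\star(H)$; ${}^g\mathfrak S_\star(H)=\mathfrak S_\star({}^gH)$. It is I-finite if $[H:I]<\infty$ for $I\in\mathfrak S_{\mathrm i}(H)$. It is a $G$-Mackey system if for $I\in\mathfrak S_{\mathrm r}(H)$, $J\in\mathfrak S_{\mathrm i}(H)$ the set $I\backslash H/J$ is finite, $I\cap J\in\mathfrak S_{\mathrm r}(J)$ and $I\cap J\in\mathfrak S_{\mathrm i}(I)$. A RIC-functor $\Phi:\mathfrak S\to\mathsf{Ab}$ consists of abelian groups $\Phi(H)$ and homomorphisms $\mathrm{res}_{I,H}:\Phi(H)\to\Phi(I)$ ($I\in\mathfrak S_{\mathrm r}(H)$), $\mathrm{ind}_{H,I}:\Phi(I)\to\Phi(H)$ ($I\in\mathfrak S_{\mathrm i}(H)$), $\mathrm{con}_{g,H}:\Phi(H)\to\Phi({}^gH)$ ($g\in G$) with $\mathrm{res}_{H,H}=\mathrm{ind}_{H,H}=\mathrm{con}_{1,H}=\mathrm{id}$;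 $\mathrm{res}_{J,I}\mathrm{res}_{I,H}=\mathrm{res}_{J,H}$, $\mathrm{ind}_{H,I}\mathrm{ind}_{I,J}=\mathrm{ind}_{H,J}$, $\mathrm{con}_{g',{}^gH}\mathrm{con}_{g,H}=\mathrm{con}_{g'g,H}$; $\mathrm{con}_{g,I}\mathrm{res}_{I,H}=\mathrm{res}_{{}^gI,{}^gH}\mathrm{con}_{g,H}$, $\mathrm{con}_{g,H}\mathrm{ind}_{H,I}=\mathrm{ind}_{{}^gH,{}^gI}\mathrm{con}_{g,I}$. It is stable if $\mathrm{con}_{h,H}=\mathrm{id}$ for all $h\in H$; cohomological if $\mathrm{ind}_{H,I}\mathrm{res}_{I,H}=[H:I]\cdot\mathrm{id}$ for $I\in\mathfrak S_{\mathrm r}(H)\cap\mathfrak S_{\mathrm i}(H)$. A Mackey functor is a stable RIC-functor on a Mackey system such that $\mathrm{res}_{I,H}\mathrm{ind}_{H,J}=\sum_{h}\mathrm{ind}_{I,I\cap{}^hJ}\,\mathrm{con}_{h,I^h\cap J}\,\mathrm{res}_{I^h\cap J,J}$ for $I\in\mathfrak M_{\mathrm r}(H)$, $J\in\mathfrak M_{\mathrm i}(H)$, $h$ running over representatives of $I\backslash H/J$. -}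

module Defs where

open import Algebra.Bundles using (RawGroup; Group; AbelianGroup)
open import Algebra.Morphism.Bundles using (GroupHomomorphism)
import Algebra.Definitions.RawMonoid as RawMonoidOps
import Algebra.Properties.Group as GroupProperties
open import Data.Fin.Base using (Fin)
open import Data.Nat.Base using (ℕ)
open import Data.Product using (Σ; Σ-syntax; ∃-syntax; ∃!; _×_; _,_; proj₁; proj₂; uncurry)
open import Data.Product.Relation.Binary.Pointwise.NonDependent using (×-setoid)
open import Data.Unit.Polymorphic using (⊤)
open import Level using (Level; suc; Lift)
open import Relation.Binary.Bundles using (Setoid)
open import Relation.Binary.Definitions using (_Respects_)
open import Relation.Binary.PropositionalEquality.Core using (_≡_)
import Relation.Binary.Reasoning.Setoid as SetoidReasoning
open import Relation.Unary using (Pred; _∈_; _⊆_; _≐_; _∩_; ⋃; _⊢_)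

private
  variable
    u : Level

-- Throughout, "set" means an element of `Set u` for one fixed universe u, so
-- that subsets, open sets, index sets and cosets all live at the same level.

record Topology (X : Setoid u u) : Set (suc (suc u)) where
  open Setoid X
  field
    Open           : Pred (Pred Carrier u) (suc u)
    Open-resp-≐    : ∀ {U V} → U ≐ V → Open U → Open V
    Open⇒respects  : ∀ {U} → Open U → U Respects _≈_
    Open-universal : Open (λ _ → ⊤)
    Open-∩         : ∀ {U V} → Open U → Open V → Open (U ∩ V)
    Open-⋃         : (I : Set u) (U : I → Pred Carrier u) →
                     (∀ i → Open (U i)) → Open (⋃ I U)

open Topology using (Open)

Continuous : {X Y : Setoid u u} → Topology X → Topology Y →
             (Setoid.Carrier X → Setoid.Carrier Y) → Set (suc u)
Continuous τ σ f = ∀ {V} → Open σ V → Open τ (f ⊢ V)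

discrete : (X : Setoid u u) → Topology X
discrete {u} X = record
  { Open           = λ U → Lift (suc u) (U Respects _≈_)
  ; Open-resp-≐    = λ (U⊆V , V⊆U) (Level.lift r) →
                       Level.lift λ x≈y x∈V → U⊆V (r x≈y (V⊆U x∈V))
  ; Open⇒respects  = Level.lower
  ; Open-universal = Level.lift λ _ t → t
  ; Open-∩         = λ (Level.lift r) (Level.lift s) →
                       Level.lift λ x≈y (p , q) → r x≈y p , s x≈y q
  ; Open-⋃         = λ I U r → Level.lift λ x≈y (i , p) → i , Level.lower (r i) x≈y p
  }
  where open Setoid X

_×ₜ_ : {X Y : Setoid u u} → Topology X → Topology Y → Topology (×-setoid X Y)
_×ₜ_ {u} {X} {Y} τ σ = record
  { Open           = OpenBox
  ; Open-resp-≐    = λ (U⊆V , V⊆U) o p →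
      let A , B , oA , oB , a , b , AB⊆U = o (V⊆U p)
      in A , B , oA , oB , a , b , λ a′ b′ → U⊆V (AB⊆U a′ b′)
  ; Open⇒respects  = λ o (x≈x′ , y≈y′) p →
      let A , B , oA , oB , a , b , AB⊆U = o p
      in AB⊆U (τ.Open⇒respects oA x≈x′ a) (σ.Open⇒respects oB y≈y′ b)
  ; Open-universal = λ _ →
      (λ _ → ⊤) , (λ _ → ⊤) , τ.Open-universal , σ.Open-universal , _ , _ , _
  ; Open-∩         = λ o o′ (p , p′) →
      let A  , B  , oA  , oB  , a  , b  , AB⊆U   = o p
          A′ , B′ , oA′ , oB′ , a′ , b′ , AB′⊆U′ = o′ p′
      in A ∩ A′ , B ∩ B′ , τ.Open-∩ oA oA′ , σ.Open-∩ oB oB′ , (a , a′) , (b , b′) ,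
         λ (c , c′) (d , d′) → AB⊆U c d , AB′⊆U′ c′ d′
  ; Open-⋃         = λ I U o (i , p) →
      let A , B , oA , oB , a , b , AB⊆U = o i p
      in A , B , oA , oB , a , b , λ a′ b′ → i , AB⊆U a′ b′
  }
  where
  module X = Setoid X
  module Y = Setoid Y
  module τ = Topology τ
  module σ = Topology σ
  OpenBox : Pred (Pred (X.Carrier × Y.Carrier) u) (suc u)
  OpenBox U = ∀ {x y} → U (x , y) →
    Σ[ A ∈ Pred X.Carrier u ] Σ[ B ∈ Pred Y.Carrier u ]
      Open τ A × Open σ B × A x × B y ×
      (∀ {x′ y′} → A x′ → B y′ → U (x′ , y′))

record TopologicalGroup (u : Level) : Set (suc (suc u)) where
  field
    group : Group u u
  open Group group public
  field
    topology      : Topology setoid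
    ∙-continuous  : Continuous (topology ×ₜ topology) topology (uncurry _∙_)
    ⁻¹-continuous : Continuous topology topology _⁻¹

record DiscreteModule {u} (G : TopologicalGroup u) : Set (suc u) where
  private module G = TopologicalGroup G
  field
    abelianGroup : AbelianGroup u u
  open AbelianGroup abelianGroup public renaming (_∙_ to _+_; ε to 0#; _⁻¹ to -_)
  infixr 8 _·_
  field
    _·_          : G.Carrier → Carrier → Carrier
    ·-cong       : ∀ {g h a b} → g G.≈ h → a ≈ b → g · a ≈ h · b
    ·-identity   : ∀ a → G.ε · a ≈ a
    ·-assoc      : ∀ g h a → (g G.∙ h) · a ≈ g · h · a
    ·-distrib-+  : ∀ g a b → g · (a + b) ≈ g · a + g · b
    ·-continuous : Continuous (G.topology ×ₜ discrete setoid) (discrete setoid) (uncurry _·_)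

record Subgroup {u} (G : Group u u) : Set (suc u) where
  open Group G
  field
    member : Pred Carrier u
    resp   : member Respects _≈_
    ε∈     : ε ∈ member
    ∙∈     : ∀ {x y} → x ∈ member → y ∈ member → x ∙ y ∈ member
    ⁻¹∈    : ∀ {x} → x ∈ member → x ⁻¹ ∈ member

open Subgroup using (member)

module _ {G : Group u u} where
  open Group G
  open GroupProperties G
  open SetoidReasoning setoid

  infix 4 _∈ˢ_ _≤_ _≃_
  infixr 5 _∩ˢ_
  infixr 6 _▸_
  infixl 6 _◂_

  _∈ˢ_ : Carrier → Subgroup G → Set u
  x ∈ˢ H = x ∈ member H

  _≤_ : Subgroup G → Subgroup G → Set u
  I ≤ H = member I ⊆ member H

  _≃_ : Subgroup G → Subgroup G → Set u
  H ≃ K = member H ≐ member K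

  _∩ˢ_ : Subgroup G → Subgroup G → Subgroup G
  I ∩ˢ J = record
    { member = member I ∩ member J
    ; resp   = λ x≈y (p , q) → I.resp x≈y p , J.resp x≈y q
    ; ε∈     = I.ε∈ , J.ε∈
    ; ∙∈     = λ (p , q) (p′ , q′) → I.∙∈ p p′ , J.∙∈ q q′
    ; ⁻¹∈    = λ (p , q) → I.⁻¹∈ p , J.⁻¹∈ q
    }
    where
    module I = Subgroup I
    module J = Subgroup J

  private
    conj : Carrier → Carrier → Carrier
    conj g x = g ∙ x ∙ g ⁻¹

    conj-congʳ : ∀ g {x y} → x ≈ y → conj g x ≈ conj g y
    conj-congʳ g x≈y = ∙-congʳ (∙-congˡ x≈y)

    conj-congˡ : ∀ {g h} x → g ≈ h → conj g x ≈ conj h x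
    conj-congˡ x g≈h = ∙-cong (∙-congʳ g≈h) (⁻¹-cong g≈h)

    conj-identity : ∀ x → conj ε x ≈ x
    conj-identity x = begin
      ε ∙ x ∙ ε ⁻¹  ≈⟨ ∙-cong (identityˡ x) ε⁻¹≈ε ⟩
      x ∙ ε         ≈⟨ identityʳ x ⟩
      x             ∎

    conj-assoc : ∀ g h x → conj g (conj h x) ≈ conj (g ∙ h) x
    conj-assoc g h x = begin
      g ∙ (h ∙ x ∙ h ⁻¹) ∙ g ⁻¹    ≈⟨ ∙-congʳ (assoc g (h ∙ x) (h ⁻¹)) ⟨
      g ∙ (h ∙ x) ∙ h ⁻¹ ∙ g ⁻¹    ≈⟨ ∙-congʳ (∙-congʳ (assoc g h x)) ⟨
      g ∙ h ∙ x ∙ h ⁻¹ ∙ g ⁻¹      ≈⟨ assoc (g ∙ h ∙ x) (h ⁻¹) (g ⁻¹) ⟩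
      g ∙ h ∙ x ∙ (h ⁻¹ ∙ g ⁻¹)    ≈⟨ ∙-congˡ (⁻¹-anti-homo-∙ g h) ⟨
      g ∙ h ∙ x ∙ (g ∙ h) ⁻¹       ∎

    conj-inverseʳ : ∀ g x → conj g (conj (g ⁻¹) x) ≈ x
    conj-inverseʳ g x = begin
      conj g (conj (g ⁻¹) x)  ≈⟨ conj-assoc g (g ⁻¹) x ⟩
      conj (g ∙ g ⁻¹) x       ≈⟨ conj-congˡ x (inverseʳ g) ⟩
      conj ε x                ≈⟨ conj-identity x ⟩
      x                       ∎

    conj-inverseˡ : ∀ g x → conj (g ⁻¹) (conj g x) ≈ x
    conj-inverseˡ g x = begin
      conj (g ⁻¹) (conj g x)  ≈⟨ conj-assoc (g ⁻¹) g x ⟩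
      conj (g ⁻¹ ∙ g) x       ≈⟨ conj-congˡ x (inverseˡ g) ⟩
      conj ε x                ≈⟨ conj-identity x ⟩
      x                       ∎

    conj-ε : ∀ g → conj g ε ≈ ε
    conj-ε g = trans (∙-congʳ (identityʳ g)) (inverseʳ g)

    conj-∙ : ∀ g x y → conj g x ∙ conj g y ≈ conj g (x ∙ y)
    conj-∙ g x y = begin
      (g ∙ x ∙ g ⁻¹) ∙ (g ∙ y ∙ g ⁻¹)    ≈⟨ assoc (conj g x) (g ∙ y) (g ⁻¹) ⟨
      (g ∙ x ∙ g ⁻¹) ∙ (g ∙ y) ∙ g ⁻¹    ≈⟨ ∙-congʳ (assoc (g ∙ x) (g ⁻¹) (g ∙ y)) ⟩
      g ∙ x ∙ (g ⁻¹ ∙ (g ∙ y)) ∙ g ⁻¹    ≈⟨ ∙-congʳ (∙-congˡ (\\-leftDividesʳ g y)) ⟩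
      g ∙ x ∙ y ∙ g ⁻¹                   ≈⟨ ∙-congʳ (assoc g x y) ⟩
      g ∙ (x ∙ y) ∙ g ⁻¹                 ∎

    conj-⁻¹ : ∀ g x → conj g x ⁻¹ ≈ conj g (x ⁻¹)
    conj-⁻¹ g x = sym (inverseʳ-unique (conj g x) (conj g (x ⁻¹)) (begin
      conj g x ∙ conj g (x ⁻¹)  ≈⟨ conj-∙ g x (x ⁻¹) ⟩
      conj g (x ∙ x ⁻¹)         ≈⟨ conj-congʳ g (inverseʳ x) ⟩
      conj g ε                  ≈⟨ conj-ε g ⟩
      ε                         ∎))

  -- g ▸ H is ᵍH = gHg⁻¹.
  _▸_ : Carrier → Subgroup G → Subgroup G
  g ▸ H = record
    { member = λ x → ∃[ h ] h ∈ˢ H × x ≈ g ∙ h ∙ g ⁻¹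
    ; resp   = λ x≈y (h , h∈H , e) → h , h∈H , trans (sym x≈y) e
    ; ε∈     = ε , H.ε∈ , sym (conj-ε g)
    ; ∙∈     = λ (h , h∈H , e) (k , k∈H , f) →
                 h ∙ k , H.∙∈ h∈H k∈H , trans (∙-cong e f) (conj-∙ g h k)
    ; ⁻¹∈    = λ (h , h∈H , e) →
                 h ⁻¹ , H.⁻¹∈ h∈H , trans (⁻¹-cong e) (conj-⁻¹ g h)
    }
    where module H = Subgroup H

  -- H ◂ g is Hᵍ = g⁻¹Hg.
  _◂_ : Subgroup G → Carrier → Subgroup G
  H ◂ g = g ⁻¹ ▸ H

  ▸-congˡ : ∀ {g h} H → g ≈ h → g ▸ H ≃ h ▸ H
  ▸-congˡ H g≈h =
      (λ (x , x∈H , e) → x , x∈H , trans e (conj-congˡ x g≈h))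
    , (λ (x , x∈H , e) → x , x∈H , trans e (conj-congˡ x (sym g≈h)))

  ▸-congʳ : ∀ g {H K} → H ≃ K → g ▸ H ≃ g ▸ K
  ▸-congʳ g (H⊆K , K⊆H) =
      (λ (x , x∈H , e) → x , H⊆K x∈H , e)
    , (λ (x , x∈K , e) → x , K⊆H x∈K , e)

  ▸-identity : ∀ H → ε ▸ H ≃ H
  ▸-identity H =
      (λ (h , h∈H , e) → Subgroup.resp H (sym (trans e (conj-identity h))) h∈H)
    , (λ {x} x∈H → x , x∈H , sym (conj-identity x))

  ▸-assoc : ∀ g h H → g ▸ h ▸ H ≃ (g ∙ h) ▸ H
  ▸-assoc g h H =
      (λ (y , (x , x∈H , e) , f) →
         x , x∈H , trans f (trans (conj-congʳ g e) (conj-assoc g h x)))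
    , (λ (x , x∈H , e) →
         conj h x , (x , x∈H , refl) , trans e (sym (conj-assoc g h x)))

  ▸-self : ∀ {h} H → h ∈ˢ H → h ▸ H ≃ H
  ▸-self {h} H h∈H =
      (λ (x , x∈H , e) → H.resp (sym e) (H.∙∈ (H.∙∈ h∈H x∈H) (H.⁻¹∈ h∈H)))
    , (λ {x} x∈H → conj (h ⁻¹) x
                 , H.∙∈ (H.∙∈ (H.⁻¹∈ h∈H) x∈H) (H.⁻¹∈ (H.⁻¹∈ h∈H))
                 , sym (conj-inverseʳ h x))
    where module H = Subgroup H

  ▸-◂-∩ : ∀ h I J → h ▸ ((I ◂ h) ∩ˢ J) ≃ I ∩ˢ (h ▸ J)
  ▸-◂-∩ h I J =
      (λ (y , ((x , x∈I , e) , y∈J) , f) →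
           Subgroup.resp I (sym (trans f (trans (conj-congʳ h e) (conj-inverseʳ h x)))) x∈I
         , (y , y∈J , f))
    , (λ {x} (x∈I , (y , y∈J , e)) →
           y
         , ((x , x∈I , trans (sym (conj-inverseˡ h y)) (conj-congʳ (h ⁻¹) (sym e))) , y∈J)
         , e)

  LeftCoset : Carrier → Subgroup G → Pred Carrier u
  LeftCoset t I x = ∃[ y ] y ∈ˢ I × x ≈ t ∙ y

  DoubleCoset : Subgroup G → Carrier → Subgroup G → Pred Carrier u
  DoubleCoset I t J x = ∃[ y ] ∃[ z ] y ∈ˢ I × z ∈ˢ J × x ≈ y ∙ t ∙ z

  -- A finite left transversal of I in H, listed without repetition. For I ≤ H,
  -- having one is the finiteness of [H : I], and its size is [H : I].
  record LeftTransversal (I H : Subgroup G) : Set u where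
    field
      size  : ℕ
      rep   : Fin size → Carrier
      rep∈  : ∀ k → rep k ∈ˢ H
      cover : ∀ {x} → x ∈ˢ H → ∃! _≡_ (λ k → x ∈ LeftCoset (rep k) I)

  -- Likewise for the set I \ H / J of double cosets.
  record DoubleTransversal (I H J : Subgroup G) : Set u where
    field
      size  : ℕ
      rep   : Fin size → Carrier
      rep∈  : ∀ k → rep k ∈ˢ H
      cover : ∀ {x} → x ∈ˢ H → ∃! _≡_ (λ k → x ∈ DoubleCoset I (rep k) J)

data Kind : Set where
  𝐫 𝐢 : Kind

record SubgroupSystem {u} (G : Group u u) : Set (suc (suc u)) where
  open Group G using (Carrier)
  field
    -- Sets of subgroups are predicates respecting equality of subgroups.
    Base      : Pred (Subgroup G) (suc u)
    Base-resp : ∀ {H K} → H ≃ K → H ∈ Base → K ∈ Base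
    nonEmpty  : Σ[ H ∈ Subgroup G ] H ∈ Base
    Base-▸    : ∀ g {H} → H ∈ Base → g ▸ H ∈ Base

    -- Only the values Sub ⋆ H with H ∈ Base matter.
    Sub       : Kind → Subgroup G → Pred (Subgroup G) (suc u)
    Sub-resp  : ∀ ⋆ {H K I J} → H ∈ Base → H ≃ K → I ≃ J → I ∈ Sub ⋆ H → J ∈ Sub ⋆ K
    Sub-Base  : ∀ ⋆ {H I} → H ∈ Base → I ∈ Sub ⋆ H → I ∈ Base
    Sub-≤     : ∀ ⋆ {H I} → H ∈ Base → I ∈ Sub ⋆ H → I ≤ H
    Sub-refl  : ∀ ⋆ {H} → H ∈ Base → H ∈ Sub ⋆ H
    Sub-trans : ∀ ⋆ {H I} → H ∈ Base → I ∈ Sub ⋆ H → Sub ⋆ I ⊆ Sub ⋆ H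
    Sub-▸     : ∀ ⋆ g {H} → H ∈ Base →
                (λ K → ∃[ I ] I ∈ Sub ⋆ H × K ≃ g ▸ I) ≐ Sub ⋆ (g ▸ H)

  Member : Set (suc u)
  Member = Σ[ H ∈ Subgroup G ] H ∈ Base

  infix 4 _≃ᵐ_ _∈⟨_⟩_
  infixr 6 _▸ᵐ_

  _≃ᵐ_ : Member → Member → Set u
  H ≃ᵐ K = proj₁ H ≃ proj₁ K

  _▸ᵐ_ : Carrier → Member → Member
  g ▸ᵐ (H , H∈) = g ▸ H , Base-▸ g H∈

  -- I ∈⟨ ⋆ ⟩ H means I ∈ 𝔖⋆(H).
  _∈⟨_⟩_ : Member → Kind → Member → Set (suc u)
  I ∈⟨ ⋆ ⟩ H = proj₁ I ∈ Sub ⋆ (proj₁ H)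

  ∈-▸ : ∀ {⋆} g {I H} → I ∈⟨ ⋆ ⟩ H → g ▸ᵐ I ∈⟨ ⋆ ⟩ g ▸ᵐ H
  ∈-▸ {⋆} g {I , _} {H , H∈} p =
    proj₁ (Sub-▸ ⋆ g H∈) (I , p , (λ x∈ → x∈) , (λ x∈ → x∈))

  ∈-▸-self : ∀ {⋆ h} {I H : Member} → h ∈ˢ proj₁ H → I ∈⟨ ⋆ ⟩ H → h ▸ᵐ I ∈⟨ ⋆ ⟩ H
  ∈-▸-self {⋆} {h} {I} {H} h∈H p =
    Sub-resp ⋆ (Base-▸ h (proj₂ H)) (▸-self (proj₁ H) h∈H)
             ((λ x∈ → x∈) , (λ x∈ → x∈)) (∈-▸ h {I} {H} p)

IFinite : {G : Group u u} → SubgroupSystem G → Set (suc u)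
IFinite S = ∀ {H I} → I ∈⟨ 𝐢 ⟩ H → LeftTransversal (proj₁ I) (proj₁ H)
  where open SubgroupSystem S

record IsMackeySystem {G : Group u u} (S : SubgroupSystem G) : Set (suc u) where
  open Group G using (_⁻¹)
  open SubgroupSystem S
  field
    finite : ∀ {H I J} → I ∈⟨ 𝐫 ⟩ H → J ∈⟨ 𝐢 ⟩ H →
             DoubleTransversal (proj₁ I) (proj₁ H) (proj₁ J)
    ∩-res  : ∀ {H I J} → I ∈⟨ 𝐫 ⟩ H → J ∈⟨ 𝐢 ⟩ H → proj₁ I ∩ˢ proj₁ J ∈ Sub 𝐫 (proj₁ J)
    ∩-ind  : ∀ {H I J} → I ∈⟨ 𝐫 ⟩ H → J ∈⟨ 𝐢 ⟩ H → proj₁ I ∩ˢ proj₁ J ∈ Sub 𝐢 (proj₁ I)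

  module _ {H I J : Member} {h} (h∈H : h ∈ˢ proj₁ H) (p : I ∈⟨ 𝐫 ⟩ H) (q : J ∈⟨ 𝐢 ⟩ H) where

    ◂∩∈ʳ : (proj₁ I ◂ h) ∩ˢ proj₁ J ∈ Sub 𝐫 (proj₁ J)
    ◂∩∈ʳ = ∩-res {H} {(h ⁻¹) ▸ᵐ I} {J}
             (∈-▸-self {I = I} {H} (Subgroup.⁻¹∈ (proj₁ H) h∈H) p) q

    ∩▸∈ⁱ : proj₁ I ∩ˢ (h ▸ proj₁ J) ∈ Sub 𝐢 (proj₁ I)
    ∩▸∈ⁱ = ∩-ind {H} {I} {h ▸ᵐ J} p (∈-▸-self {I = J} {H} h∈H q)

    -- Iʰ ∩ J and I ∩ ʰJ
    ◂∩ ∩▸ : Member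
    ◂∩ = (proj₁ I ◂ h) ∩ˢ proj₁ J , Sub-Base 𝐫 (proj₂ J) ◂∩∈ʳ
    ∩▸ = proj₁ I ∩ˢ (h ▸ proj₁ J) , Sub-Base 𝐢 (proj₂ I) ∩▸∈ⁱ

Hom : AbelianGroup u u → AbelianGroup u u → Set u
Hom A B = GroupHomomorphism (AbelianGroup.rawGroup A) (AbelianGroup.rawGroup B)

infixr 9 _⟨$⟩_

_⟨$⟩_ : {A B : RawGroup u u} → GroupHomomorphism A B → RawGroup.Carrier A → RawGroup.Carrier B
_⟨$⟩_ = GroupHomomorphism.⟦_⟧

-- The assignment H ↦ Φ(H). Equal subgroups (in the sense of ≃) may be given by
-- different terms; `cast` is the resulting identification of their values.
record AbFamily {G : Group u u} (S : SubgroupSystem G) : Set (suc u) where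
  open SubgroupSystem S
  field
    obj : Member → AbelianGroup u u

  module Obj (H : Member) = AbelianGroup (obj H)

  field
    cast       : ∀ {H K} → H ≃ᵐ K → Hom (obj H) (obj K)
    cast-refl  : ∀ {H} (e : H ≃ᵐ H) x → Obj._≈_ H (cast {H} {H} e ⟨$⟩ x) x
    cast-trans : ∀ {H K L} (e : H ≃ᵐ K) (f : K ≃ᵐ L) (d : H ≃ᵐ L) x →
                 Obj._≈_ L (cast {K} {L} f ⟨$⟩ cast {H} {K} e ⟨$⟩ x) (cast {H} {L} d ⟨$⟩ x)

-- The structure of a RIC-functor on the family Φ. The laws named …-cast and
-- con-cong say that the maps depend only on the subgroups and on the element
-- g, up to equality.
record RICFunctorOn {G : Group u u} (S : SubgroupSystem G) (Φ : AbFamily S) : Set (suc u) where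
  open Group G using (ε; _∙_) renaming (Carrier to |G|; _≈_ to _≈ᴳ_)
  open SubgroupSystem S
  open AbFamily Φ
  field
    res : ∀ {I H} → I ∈⟨ 𝐫 ⟩ H → Hom (obj H) (obj I)
    ind : ∀ {H I} → I ∈⟨ 𝐢 ⟩ H → Hom (obj I) (obj H)
    con : ∀ g H → Hom (obj H) (obj (g ▸ᵐ H))

    res-cast : ∀ {I H I′ H′} (p : I ∈⟨ 𝐫 ⟩ H) (p′ : I′ ∈⟨ 𝐫 ⟩ H′)
               (d : I ≃ᵐ I′) (e : H ≃ᵐ H′) x →
               Obj._≈_ I′ (res {I′} {H′} p′ ⟨$⟩ cast {H} {H′} e ⟨$⟩ x)
                          (cast {I} {I′} d ⟨$⟩ res {I} {H} p ⟨$⟩ x)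
    ind-cast : ∀ {H I H′ I′} (p : I ∈⟨ 𝐢 ⟩ H) (p′ : I′ ∈⟨ 𝐢 ⟩ H′)
               (d : I ≃ᵐ I′) (e : H ≃ᵐ H′) x →
               Obj._≈_ H′ (ind {H′} {I′} p′ ⟨$⟩ cast {I} {I′} d ⟨$⟩ x)
                          (cast {H} {H′} e ⟨$⟩ ind {H} {I} p ⟨$⟩ x)
    con-cast : ∀ g {H K} (e : H ≃ᵐ K) x →
               Obj._≈_ (g ▸ᵐ K) (con g K ⟨$⟩ cast {H} {K} e ⟨$⟩ x)
                                (cast {g ▸ᵐ H} {g ▸ᵐ K} (▸-congʳ g {proj₁ H} {proj₁ K} e) ⟨$⟩ con g H ⟨$⟩ x)
    con-cong : ∀ {g h} H (e : g ≈ᴳ h) x →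
               Obj._≈_ (h ▸ᵐ H) (cast {g ▸ᵐ H} {h ▸ᵐ H} (▸-congˡ (proj₁ H) e) ⟨$⟩ con g H ⟨$⟩ x)
                                (con h H ⟨$⟩ x)

    res-id   : ∀ {H} (p : H ∈⟨ 𝐫 ⟩ H) x → Obj._≈_ H (res {H} {H} p ⟨$⟩ x) x
    ind-id   : ∀ {H} (p : H ∈⟨ 𝐢 ⟩ H) x → Obj._≈_ H (ind {H} {H} p ⟨$⟩ x) x
    con-id   : ∀ H x →
               Obj._≈_ H (cast {ε ▸ᵐ H} {H} (▸-identity (proj₁ H)) ⟨$⟩ con ε H ⟨$⟩ x) x

    res-res  : ∀ {J I H} (p : I ∈⟨ 𝐫 ⟩ H) (q : J ∈⟨ 𝐫 ⟩ I) (r : J ∈⟨ 𝐫 ⟩ H) x →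
               Obj._≈_ J (res {J} {I} q ⟨$⟩ res {I} {H} p ⟨$⟩ x) (res {J} {H} r ⟨$⟩ x)
    ind-ind  : ∀ {H I J} (p : I ∈⟨ 𝐢 ⟩ H) (q : J ∈⟨ 𝐢 ⟩ I) (r : J ∈⟨ 𝐢 ⟩ H) x →
               Obj._≈_ H (ind {H} {I} p ⟨$⟩ ind {I} {J} q ⟨$⟩ x) (ind {H} {J} r ⟨$⟩ x)
    con-con  : ∀ g′ g H x →
               Obj._≈_ ((g′ ∙ g) ▸ᵐ H)
                 (cast {g′ ▸ᵐ g ▸ᵐ H} {(g′ ∙ g) ▸ᵐ H} (▸-assoc g′ g (proj₁ H))
                    ⟨$⟩ con g′ (g ▸ᵐ H) ⟨$⟩ con g H ⟨$⟩ x)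
                 (con (g′ ∙ g) H ⟨$⟩ x)

    con-res  : ∀ g {I H} (p : I ∈⟨ 𝐫 ⟩ H) x →
               Obj._≈_ (g ▸ᵐ I) (con g I ⟨$⟩ res {I} {H} p ⟨$⟩ x)
                                (res {g ▸ᵐ I} {g ▸ᵐ H} (∈-▸ g {I} {H} p) ⟨$⟩ con g H ⟨$⟩ x)
    con-ind  : ∀ g {H I} (p : I ∈⟨ 𝐢 ⟩ H) x →
               Obj._≈_ (g ▸ᵐ H) (con g H ⟨$⟩ ind {H} {I} p ⟨$⟩ x)
                                (ind {g ▸ᵐ H} {g ▸ᵐ I} (∈-▸ g {I} {H} p) ⟨$⟩ con g I ⟨$⟩ x)

module _ {G : Group u u} {S : SubgroupSystem G} {Φ : AbFamily S} (F : RICFunctorOn S Φ) where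
  open SubgroupSystem S
  open AbFamily Φ
  open RICFunctorOn F

  Stable : Set (suc u)
  Stable = ∀ H {h} (h∈H : h ∈ˢ proj₁ H) x →
           Obj._≈_ H (cast {h ▸ᵐ H} {H} (▸-self (proj₁ H) h∈H) ⟨$⟩ con h H ⟨$⟩ x) x

  -- The condition ind ∘ res = [H : I] · id presupposes that [H : I] is finite.
  record Cohomological : Set (suc u) where
    field
      finiteIndex : ∀ {H I} → I ∈⟨ 𝐫 ⟩ H → I ∈⟨ 𝐢 ⟩ H → LeftTransversal (proj₁ I) (proj₁ H)
      ind-res     : ∀ {H I} (p : I ∈⟨ 𝐫 ⟩ H) (q : I ∈⟨ 𝐢 ⟩ H)
                    (T : LeftTransversal (proj₁ I) (proj₁ H)) x →
                    let open RawMonoidOps (Obj.rawMonoid H) renaming (_×_ to _×ᴴ_) in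
                    Obj._≈_ H (ind {H} {I} q ⟨$⟩ res {I} {H} p ⟨$⟩ x)
                              (LeftTransversal.size T ×ᴴ x)

  record IsMackeyFunctor (M : IsMackeySystem S) : Set (suc u) where
    open IsMackeySystem M
    field
      stable : Stable
      mackey : ∀ {H I J} (p : I ∈⟨ 𝐫 ⟩ H) (q : J ∈⟨ 𝐢 ⟩ H)
               (R : DoubleTransversal (proj₁ I) (proj₁ H) (proj₁ J)) x →
               let open DoubleTransversal R
                   open RawMonoidOps (Obj.rawMonoid I) using (sum)
               in
               Obj._≈_ I (res {I} {H} p ⟨$⟩ ind {H} {J} q ⟨$⟩ x)
                 (sum λ k →
                   let h   = rep k
                       h∈  = rep∈ k
                       Iʰ∩J = ◂∩ {H} {I} {J} h∈ p q
                       I∩ʰJ = ∩▸ {H} {I} {J} h∈ p q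
                   in
                   ind {I} {I∩ʰJ} (∩▸∈ⁱ {H} {I} {J} h∈ p q)
                     ⟨$⟩ cast {h ▸ᵐ Iʰ∩J} {I∩ʰJ} (▸-◂-∩ h (proj₁ I) (proj₁ J))
                     ⟨$⟩ con h Iʰ∩J
                     ⟨$⟩ res {Iʰ∩J} {J} (◂∩∈ʳ {H} {I} {J} h∈ p q)
                     ⟨$⟩ x)

module _ {G : TopologicalGroup u} (A : DiscreteModule G) where
  private
    module G = TopologicalGroup G
    module A = DiscreteModule A
  open A using (_·_)

  private
    ·-0# : ∀ g → g · A.0# A.≈ A.0#
    ·-0# g = identityʳ-unique (g · A.0#) (g · A.0#)
      (A.trans (A.sym (A.·-distrib-+ g A.0# A.0#)) (A.·-cong G.refl (A.identityʳ A.0#)))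
      where open GroupProperties A.group

    ·-neg : ∀ g a → g · (A.- a) A.≈ A.- (g · a)
    ·-neg g a = inverseʳ-unique (g · a) (g · (A.- a))
      (A.trans (A.sym (A.·-distrib-+ g a (A.- a)))
        (A.trans (A.·-cong G.refl (A.inverseʳ a)) (·-0# g)))
      where open GroupProperties A.group

  Invariant : Subgroup G.group → Pred A.Carrier u
  Invariant H a = ∀ {h} → h ∈ˢ H → h · a A.≈ a

  fixedPoints : Subgroup G.group → AbelianGroup u u
  fixedPoints H = record
    { Carrier = Σ[ a ∈ A.Carrier ] Invariant H a
    ; _≈_     = λ x y → proj₁ x A.≈ proj₁ y
    ; _∙_     = λ (a , i) (b , j) → a A.+ b ,
                  λ {h} h∈H → A.trans (A.·-distrib-+ h a b) (A.∙-cong (i h∈H) (j h∈H))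
    ; ε       = A.0# , λ {h} _ → ·-0# h
    ; _⁻¹     = λ (a , i) → A.- a ,
                  λ {h} h∈H → A.trans (·-neg h a) (A.⁻¹-cong (i h∈H))
    ; isAbelianGroup = record
      { isGroup = record
        { isMonoid = record
          { isSemigroup = record
            { isMagma = record
              { isEquivalence = record { refl = A.refl ; sym = A.sym ; trans = A.trans }
              ; ∙-cong        = A.∙-cong
              }
            ; assoc = λ (a , _) (b , _) (c , _) → A.assoc a b c
            }
          ; identity = (λ (a , _) → A.identityˡ a) , (λ (a , _) → A.identityʳ a)
          }
        ; inverse = (λ (a , _) → A.inverseˡ a) , (λ (a , _) → A.inverseʳ a)
        ; ⁻¹-cong = A.⁻¹-cong
        }
      ; comm = λ (a , _) (b , _) → A.comm a b
      }
    }

  fixedPointFamily : (S : SubgroupSystem G.group) → AbFamily S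
  fixedPointFamily S = record
    { obj        = λ (H , _) → fixedPoints H
    ; cast       = λ (_ , K⊆H) → record
      { ⟦_⟧ = λ (a , i) → a , λ k∈K → i (K⊆H k∈K)
      ; isGroupHomomorphism = record
        { isMonoidHomomorphism = record
          { isMagmaHomomorphism = record
            { isRelHomomorphism = record { cong = λ e → e }
            ; homo = λ _ _ → A.refl
            }
          ; ε-homo = A.refl
          }
        ; ⁻¹-homo = λ _ → A.refl
        }
      }
    ; cast-refl  = λ _ _ → A.refl
    ; cast-trans = λ _ _ _ _ → A.refl
    }

  -- The structure maps of a RIC-functor on H ↦ Aᴴ are those of H⁰(A). Since
  -- equality in Aᴴ is equality in A, this determines res, ind and con.
  record IsH⁰ {S : SubgroupSystem G.group}
              (F : RICFunctorOn S (fixedPointFamily S)) : Set (suc u) where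
    open SubgroupSystem S
    open RICFunctorOn F
    open RawMonoidOps A.rawMonoid using (sum)
    field
      res-inclusion   : ∀ {I H} (p : I ∈⟨ 𝐫 ⟩ H) x →
                        proj₁ (res {I} {H} p ⟨$⟩ x) A.≈ proj₁ x
      ind-transversal : ∀ {H I} (p : I ∈⟨ 𝐢 ⟩ H) (T : LeftTransversal (proj₁ I) (proj₁ H)) x →
                        let open LeftTransversal T in
                        proj₁ (ind {H} {I} p ⟨$⟩ x) A.≈ sum (λ k → rep k · proj₁ x)
      con-action      : ∀ g H x → proj₁ (con g H ⟨$⟩ x) A.≈ g · proj₁ x

{-# OPTIONS --safe #-}

-- The trace Σ t a of an I-invariant a over a left transversal of I in H does not
-- depend on the transversal, so every identity between traces amounts to exhibiting
-- a suitable transversal: hT for the H-invariance of the trace, gTg⁻¹ for conjugation,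
-- the products of T and T′ for transitivity of induction. The Mackey formula comes from
-- the decomposition of H into double cosets: if h runs over I \ H / J and t over a left
-- transversal of I ∩ ʰJ in I, then the elements t h form a left transversal of J in H.

module Submission where

open import Defs
open import Algebra.Bundles using (Group; AbelianGroup; CommutativeMonoid)
open import Algebra.Morphism.Bundles using (module GroupHomomorphism)
import Algebra.Definitions.RawMonoid as RawMonoidOps
import Algebra.Properties.CommutativeMonoid.Sum as CommutativeMonoidSum
import Algebra.Properties.Group as GroupProperties
open import Data.Fin.Base using (Fin; zero; suc; splitAt; _↑ˡ_; _↑ʳ_)
open import Data.Fin.Permutation using (Permutation; permutation)
open import Data.Fin.Properties using (splitAt-↑ˡ; splitAt-↑ʳ; splitAt⁻¹-↑ˡ; splitAt⁻¹-↑ʳ)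
open import Data.Nat.Base as ℕ using (ℕ; zero; suc)
open import Data.Product using (Σ; Σ-syntax; ∃!; _×_; _,_; proj₁; proj₂)
open import Data.Sum.Base using ([_,_]′; inj₁; inj₂)
open import Data.Vec.Functional using (replicate)
open import Function.Base using (_∘_; id)
open import Function.Bundles using (_↔_; mk↔ₛ′; module Inverse)
open import Relation.Binary.PropositionalEquality.Core as ≡ using (_≡_)
import Relation.Binary.Reasoning.Setoid as SetoidReasoning
open import Relation.Unary using (_∈_)

total : ∀ {m} → (Fin m → ℕ) → ℕ
total {zero}  n = 0
total {suc m} n = n zero ℕ.+ total (n ∘ suc)

next : ∀ {m} (n : Fin (suc m) → ℕ) → Σ (Fin m) (Fin ∘ n ∘ suc) → Σ (Fin (suc m)) (Fin ∘ n)
next n (i , j) = suc i , j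

unflatten : ∀ {m} (n : Fin m → ℕ) → Fin (total n) → Σ (Fin m) (Fin ∘ n)
unflatten {suc m} n k =
  [ (zero ,_) , next n ∘ unflatten (n ∘ suc) ]′ (splitAt (n zero) k)

flatten : ∀ {m} (n : Fin m → ℕ) → Σ (Fin m) (Fin ∘ n) → Fin (total n)
flatten n (zero  , j) = j ↑ˡ total (n ∘ suc)
flatten n (suc i , j) = n zero ↑ʳ flatten (n ∘ suc) (i , j)

unflatten-flatten : ∀ {m} (n : Fin m → ℕ) p → unflatten n (flatten n p) ≡ p
unflatten-flatten n (zero , j)
  rewrite splitAt-↑ˡ (n zero) j (total (n ∘ suc)) = ≡.refl
unflatten-flatten n (suc i , j)
  rewrite splitAt-↑ʳ (n zero) (total (n ∘ suc)) (flatten (n ∘ suc) (i , j)) =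
  ≡.cong (next n) (unflatten-flatten (n ∘ suc) (i , j))

flatten-unflatten : ∀ {m} (n : Fin m → ℕ) k → flatten n (unflatten n k) ≡ k
flatten-unflatten {suc m} n k with splitAt (n zero) k in eq
... | inj₁ j = splitAt⁻¹-↑ˡ eq
... | inj₂ j = ≡.trans (≡.cong (n zero ↑ʳ_) (flatten-unflatten (n ∘ suc) j)) (splitAt⁻¹-↑ʳ eq)

flattening : ∀ {m} (n : Fin m → ℕ) → Fin (total n) ↔ Σ (Fin m) (Fin ∘ n)
flattening n = mk↔ₛ′ (unflatten n) (flatten n) (unflatten-flatten n) (flatten-unflatten n)

module _ {c ℓ} (M : CommutativeMonoid c ℓ) where
  open CommutativeMonoid M
  open CommutativeMonoidSum M

  sum-++ : ∀ m {n} (f : Fin (m ℕ.+ n) → Carrier) →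
           sum f ≈ sum (f ∘ (_↑ˡ n)) ∙ sum (f ∘ (m ↑ʳ_))
  sum-++ zero    f = sym (identityˡ _)
  sum-++ (suc m) f = trans (∙-congˡ (sum-++ m (f ∘ suc))) (sym (assoc _ _ _))

  sum-unflatten : ∀ {m} (n : Fin m → ℕ) (f : Σ (Fin m) (Fin ∘ n) → Carrier) →
                  sum (f ∘ unflatten n) ≈ sum λ i → sum λ j → f (i , j)
  sum-unflatten {zero}  n f = refl
  sum-unflatten {suc m} n f = trans (sum-++ (n zero) (f ∘ unflatten n)) (∙-cong
    (reflexive (sum-cong-≗ λ j →
      ≡.cong (f ∘ [ _ , _ ]′) (splitAt-↑ˡ (n zero) j (total (n ∘ suc)))))
    (trans
      (reflexive (sum-cong-≗ λ j →
        ≡.cong (f ∘ [ _ , _ ]′) (splitAt-↑ʳ (n zero) (total (n ∘ suc)) j)))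
      (sum-unflatten (n ∘ suc) (f ∘ next n))))

module _ {u} (A B : AbelianGroup u u) where
  private
    module A = AbelianGroup A
    module B = AbelianGroup B
  open GroupProperties B.group

  additive⇒Hom : (f : A.Carrier → B.Carrier) → (∀ {x y} → x A.≈ y → f x B.≈ f y) →
                 (∀ x y → f (x A.∙ y) B.≈ f x B.∙ f y) → Hom A B
  additive⇒Hom f f-cong f-∙ = record
    { ⟦_⟧ = f
    ; isGroupHomomorphism = record
      { isMonoidHomomorphism = record
        { isMagmaHomomorphism = record
          { isRelHomomorphism = record { cong = f-cong }
          ; homo = f-∙
          }
        ; ε-homo = f-ε
        }
      ; ⁻¹-homo = λ x → inverseʳ-unique (f x) (f (x A.⁻¹))
          (B.trans (B.sym (f-∙ x (x A.⁻¹))) (B.trans (f-cong (A.inverseʳ x)) f-ε))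
      }
    }
    where
    f-ε : f A.ε B.≈ B.ε
    f-ε = identityʳ-unique (f A.ε) (f A.ε)
      (B.trans (B.sym (f-∙ A.ε A.ε)) (f-cong (A.identityʳ A.ε)))

module _ {u} {G : Group u u} where
  open Group G
  open GroupProperties G
  open LeftTransversal

  LeftCoset-sym : ∀ (I : Subgroup G) {s t} → s ∈ LeftCoset t I → t ∈ LeftCoset s I
  LeftCoset-sym I {s} {t} (y , y∈I , s≈ty) =
    y ⁻¹ , Subgroup.⁻¹∈ I y∈I , sym (trans (∙-congʳ s≈ty) (//-rightDividesʳ y t))

  module _ {I H : Subgroup G} where

    reindex : ∀ {n} {X : Set} → Fin n ↔ X → (r : X → Carrier) → (∀ k → r k ∈ˢ H) →
              (∀ {x} → x ∈ˢ H → ∃! _≡_ (λ k → x ∈ LeftCoset (r k) I)) →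
              LeftTransversal I H
    reindex {n} π r r∈ c = record
      { size  = n
      ; rep   = r ∘ π.to
      ; rep∈  = r∈ ∘ π.to
      ; cover = λ {x} x∈H →
          let k , x∈kI , unique = c x∈H
          in π.from k
           , ≡.subst (λ l → x ∈ LeftCoset (r l) I) (≡.sym (π.strictlyInverseˡ k)) x∈kI
           , λ x∈lI → ≡.trans (≡.cong π.from (unique x∈lI)) (π.strictlyInverseʳ _)
      }
      where module π = Inverse π

    ≃-transversal : ∀ {I′ H′} → I ≃ I′ → H ≃ H′ → LeftTransversal I H → LeftTransversal I′ H′
    ≃-transversal (I⊆I′ , I′⊆I) (H⊆H′ , H′⊆H) T = record
      { size  = size T
      ; rep   = rep T
      ; rep∈  = λ k → H⊆H′ (rep∈ T k)
      ; cover = λ x∈H′ →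
          let k , (y , y∈I , e) , unique = cover T (H′⊆H x∈H′)
          in k , (y , I⊆I′ y∈I , e) , λ (z , z∈I′ , f) → unique (z , I′⊆I z∈I′ , f)
      }

    translate : ∀ {h} → h ∈ˢ H → LeftTransversal I H → LeftTransversal I H
    translate {h} h∈H T = record
      { size  = size T
      ; rep   = λ k → h ∙ rep T k
      ; rep∈  = λ k → H.∙∈ h∈H (rep∈ T k)
      ; cover = λ {x} x∈H →
          let k , (y , y∈I , e) , unique = cover T (H.∙∈ (H.⁻¹∈ h∈H) x∈H)
          in k
           , (y , y∈I , trans (sym (\\-leftDividesˡ h x))
                          (trans (∙-congˡ e) (sym (assoc h (rep T k) y))))
           , λ (z , z∈I , f) → unique
               (z , z∈I , trans (∙-congˡ (trans f (assoc h _ z))) (\\-leftDividesʳ h _))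
      }
      where module H = Subgroup H

    conjugate : I ≤ H → ∀ g → LeftTransversal I H → LeftTransversal (g ▸ I) (g ▸ H)
    conjugate I≤H g T = record
      { size  = size T
      ; rep   = λ k → g ∙ rep T k ∙ g ⁻¹
      ; rep∈  = λ k → rep T k , rep∈ T k , refl
      ; cover = λ (h , h∈H , x≈ghg⁻¹) →
          let k , (y , y∈I , e) , unique = cover T h∈H
          in k
           , ( g ∙ y ∙ g ⁻¹ , (y , y∈I , refl)
             , trans x≈ghg⁻¹ (trans (∙-congʳ (∙-congˡ e))
                 (sym (conj-∙ (rep∈ T k) (I≤H y∈I)))))
           , λ {l} (w , (z , z∈I , w≈gzg⁻¹) , f) → unique
               ( z , z∈I
               , ∙-cancelˡ g _ _ (∙-cancelʳ (g ⁻¹) _ _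
                   (trans (sym x≈ghg⁻¹) (trans f (trans (∙-congˡ w≈gzg⁻¹)
                     (conj-∙ (rep∈ T l) (I≤H z∈I)))))))
      }
      where
      conj-∙ : ∀ {a b} → a ∈ˢ H → b ∈ˢ H →
               (g ∙ a ∙ g ⁻¹) ∙ (g ∙ b ∙ g ⁻¹) ≈ g ∙ (a ∙ b) ∙ g ⁻¹
      conj-∙ {a} {b} a∈H b∈H =
        proj₂ (proj₂ (Subgroup.∙∈ (g ▸ H) (a , a∈H , refl) (b , b∈H , refl)))

  trivialTransversal : ∀ (H : Subgroup G) → LeftTransversal H H
  trivialTransversal H = record
    { size  = 1
    ; rep   = λ _ → ε
    ; rep∈  = λ _ → Subgroup.ε∈ H
    ; cover = λ {x} x∈H → zero , (x , x∈H , sym (identityˡ x)) , λ { {zero} _ → ≡.refl }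
    }

  compose : ∀ {J I H : Subgroup G} → I ≤ H → J ≤ I →
            LeftTransversal I H → LeftTransversal J I → LeftTransversal J H
  compose {J} {I} {H} I≤H J≤I S T = reindex {J} {H} (flattening λ (_ : Fin (size S)) → size T)
    (λ (i , j) → rep S i ∙ rep T j)
    (λ (i , j) → Subgroup.∙∈ H (rep∈ S i) (I≤H (rep∈ T j)))
    λ x∈H →
      let i , (y , y∈I , x≈sy) , unique-i = cover S x∈H
          j , (z , z∈J , y≈tz) , unique-j = cover T y∈I
      in (i , j)
       , (z , z∈J , trans x≈sy (trans (∙-congˡ y≈tz) (sym (assoc _ _ z))))
       , λ {(i′ , j′)} (w , w∈J , x≈stw) →
           let x≈s[tw] = trans x≈stw (assoc _ _ w)
           in same-index x≈sy unique-j
                (unique-i (_ , Subgroup.∙∈ I (rep∈ T j′) (J≤I w∈J) , x≈s[tw])) w∈J x≈s[tw]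
    where
    same-index : ∀ {x y w i i′ j j′} → x ≈ rep S i ∙ y →
                 (∀ {j′} → y ∈ LeftCoset (rep T j′) J → j ≡ j′) →
                 i ≡ i′ → w ∈ˢ J → x ≈ rep S i′ ∙ (rep T j′ ∙ w) → (i , j) ≡ (i′ , j′)
    same-index {i = i} x≈sy unique-j ≡.refl w∈J x≈stw =
      ≡.cong (i ,_) (unique-j (_ , w∈J , ∙-cancelˡ (rep S i) _ _ (trans (sym x≈sy) x≈stw)))

  composeDouble : ∀ {I H J : Subgroup G} → I ≤ H → (R : DoubleTransversal I H J) →
                  (∀ k → LeftTransversal (I ∩ˢ (DoubleTransversal.rep R k ▸ J)) I) →
                  LeftTransversal J H
  composeDouble {I} {H} {J} I≤H R T = reindex {J} {H} (flattening (size ∘ T))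
    (λ (k , l) → rep (T k) l ∙ R.rep k)
    (λ (k , l) → Subgroup.∙∈ H (I≤H (rep∈ (T k) l)) (R.rep∈ k))
    λ x∈H →
      let k , (y , z , y∈I , z∈J , x≈yhz) , unique-k = R.cover x∈H
          l , (w , (w∈I , (j , j∈J , w≈hjh⁻¹)) , y≈tw) , unique-l = cover (T k) y∈I
      in (k , l)
       , (j ∙ z , J.∙∈ j∈J z∈J , trans x≈yhz (begin
           y ∙ R.rep k ∙ z                       ≈⟨ ∙-congʳ (∙-congʳ (trans y≈tw (∙-congˡ w≈hjh⁻¹))) ⟩
           rep (T k) l ∙ (R.rep k ∙ j ∙ R.rep k ⁻¹) ∙ R.rep k ∙ z
             ≈⟨ ∙-congʳ (trans (assoc _ _ _) (∙-congˡ (//-rightDividesˡ (R.rep k) _))) ⟩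
           rep (T k) l ∙ (R.rep k ∙ j) ∙ z       ≈⟨ ∙-congʳ (assoc _ _ _) ⟨
           rep (T k) l ∙ R.rep k ∙ j ∙ z         ≈⟨ assoc _ _ _ ⟩
           rep (T k) l ∙ R.rep k ∙ (j ∙ z)       ∎))
       , λ {(k′ , l′)} (j′ , j′∈J , x≈thj′) →
           same-index y∈I z∈J x≈yhz unique-l
             (unique-k (_ , j′ , rep∈ (T k′) l′ , j′∈J , x≈thj′)) j′∈J x≈thj′
    where
    module R = DoubleTransversal R
    module I = Subgroup I
    module J = Subgroup J
    open SetoidReasoning setoid
    same-index : ∀ {x y z j′ k l k′ l′} → y ∈ˢ I → z ∈ˢ J → x ≈ y ∙ R.rep k ∙ z →
                 (∀ {l′} → y ∈ LeftCoset (rep (T k) l′) (I ∩ˢ (R.rep k ▸ J)) → l ≡ l′) →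
                 k ≡ k′ → j′ ∈ˢ J → x ≈ rep (T k′) l′ ∙ R.rep k′ ∙ j′ → (k , l) ≡ (k′ , l′)
    same-index {x} {y} {z} {j′} {k} {l′ = l′} y∈I z∈J x≈yhz unique-l ≡.refl j′∈J x≈thj′ =
      ≡.cong (k ,_) (unique-l
        ( v
        , ( I.resp (sym v≈t⁻¹y) (I.∙∈ (I.⁻¹∈ (rep∈ (T k) l′)) y∈I)
          , j′ ∙ z ⁻¹ , J.∙∈ j′∈J (J.⁻¹∈ z∈J) , refl)
        , y≈tv))
      where
      h = R.rep k
      t = rep (T k) l′
      v = h ∙ (j′ ∙ z ⁻¹) ∙ h ⁻¹
      y≈tv : y ≈ t ∙ v
      y≈tv = begin
        y                               ≈⟨ //-rightDividesʳ h y ⟨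
        y ∙ h ∙ h ⁻¹                    ≈⟨ ∙-congʳ (//-rightDividesʳ z (y ∙ h)) ⟨
        y ∙ h ∙ z ∙ z ⁻¹ ∙ h ⁻¹         ≈⟨ ∙-congʳ (∙-congʳ (trans (sym x≈yhz) x≈thj′)) ⟩
        t ∙ h ∙ j′ ∙ z ⁻¹ ∙ h ⁻¹        ≈⟨ ∙-congʳ (assoc _ _ _) ⟩
        t ∙ h ∙ (j′ ∙ z ⁻¹) ∙ h ⁻¹      ≈⟨ ∙-congʳ (assoc _ _ _) ⟩
        t ∙ (h ∙ (j′ ∙ z ⁻¹)) ∙ h ⁻¹    ≈⟨ assoc _ _ _ ⟩
        t ∙ v                           ∎
      v≈t⁻¹y : v ≈ t ⁻¹ ∙ y
      v≈t⁻¹y = trans (sym (\\-leftDividesʳ t v)) (∙-congˡ (sym y≈tv))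

module _ {u} {G : TopologicalGroup u} (A : DiscreteModule G) where
  private
    module G = TopologicalGroup G
    module A = DiscreteModule A
  open A using (_·_)
  open CommutativeMonoidSum (AbelianGroup.commutativeMonoid A.abelianGroup)
  open LeftTransversal
  open SetoidReasoning A.setoid

  action : G.Carrier → Hom A.abelianGroup A.abelianGroup
  action g = additive⇒Hom A.abelianGroup A.abelianGroup (g ·_) (A.·-cong G.refl) (A.·-distrib-+ g)

  ·-sum : ∀ g {n} (f : Fin n → A.Carrier) → g · sum f A.≈ sum λ k → g · f k
  ·-sum g {zero}  f = GroupHomomorphism.ε-homo (action g)
  ·-sum g {suc n} f = A.trans (A.·-distrib-+ g _ _) (A.∙-congˡ (·-sum g (f ∘ suc)))

  fixedPoints-sum : ∀ H {n} (f : Fin n → AbelianGroup.Carrier (fixedPoints A H)) →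
                    proj₁ (RawMonoidOps.sum (AbelianGroup.rawMonoid (fixedPoints A H)) f)
                      A.≈ sum (proj₁ ∘ f)
  fixedPoints-sum H {zero}  f = A.refl
  fixedPoints-sum H {suc n} f = A.∙-congˡ (fixedPoints-sum H (f ∘ suc))

  module _ {I H : Subgroup G.group} where

    orbit : (T : LeftTransversal I H) → A.Carrier → Fin (size T) → A.Carrier
    orbit T a k = rep T k · a

    trace : LeftTransversal I H → A.Carrier → A.Carrier
    trace T a = sum (orbit T a)

    trace-cong : ∀ T {a b} → a A.≈ b → trace T a A.≈ trace T b
    trace-cong T a≈b = sum-cong-≋ {size T} λ k → A.·-cong G.refl a≈b

    trace-+ : ∀ T a b → trace T (a A.+ b) A.≈ trace T a A.+ trace T b
    trace-+ T a b = A.trans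
      (sum-cong-≋ {size T} λ k → A.·-distrib-+ (rep T k) a b)
      (∑-distrib-+ (orbit T a) (orbit T b))

    trace-independent : ∀ (S T : LeftTransversal I H) {a} → Invariant A I a →
                        trace S a A.≈ trace T a
    trace-independent S T {a} inv = A.sym (A.trans (sum-permute (orbit T a) π)
      (sum-cong-≋ {size S} λ k →
        let y , y∈I , e = match-∈ S T k in begin
          rep T (match S T k) · a      ≈⟨ A.·-cong G.refl (inv y∈I) ⟨
          rep T (match S T k) · y · a  ≈⟨ A.·-assoc _ y a ⟨
          (rep T (match S T k) G.∙ y) · a  ≈⟨ A.·-cong e A.refl ⟨
          rep S k · a                  ∎))
      where
      match : (S T : LeftTransversal I H) → Fin (size S) → Fin (size T)
      match S T k = proj₁ (cover T (rep∈ S k))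
      match-∈ : ∀ S T k → rep S k ∈ LeftCoset (rep T (match S T k)) I
      match-∈ S T k = proj₁ (proj₂ (cover T (rep∈ S k)))
      match-match : ∀ S T k → match T S (match S T k) ≡ k
      match-match S T k = proj₂ (proj₂ (cover S (rep∈ T (match S T k))))
        (LeftCoset-sym I (match-∈ S T k))
      π : Permutation (size S) (size T)
      π = permutation (match S T) (match T S) (match-match T S) (match-match S T)

    trace-invariant : ∀ T {a} → Invariant A I a → Invariant A H (trace T a)
    trace-invariant T {a} inv {h} h∈H = begin
      h · trace T a               ≈⟨ ·-sum h (orbit T a) ⟩
      sum (λ k → h · rep T k · a) ≈⟨ sum-cong-≋ {size T} (λ k → A.·-assoc h (rep T k) a) ⟨
      trace (translate h∈H T) a   ≈⟨ trace-independent (translate h∈H T) T inv ⟩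
      trace T a                   ∎

    trace-conjugate : ∀ (I≤H : I ≤ H) g T a →
                      g · trace T a A.≈ sum λ k → rep (conjugate {I = I} {H} I≤H g T) k · g · a
    trace-conjugate I≤H g T a = A.trans (·-sum g (orbit T a)) (sum-cong-≋ {size T} λ k → begin
      g · rep T k · a                         ≈⟨ A.·-assoc g (rep T k) a ⟨
      (g G.∙ rep T k) · a                     ≈⟨ A.·-cong (//-rightDividesˡ g _) A.refl ⟨
      (g G.∙ rep T k G.∙ g G.⁻¹ G.∙ g) · a    ≈⟨ A.·-assoc _ g a ⟩
      (g G.∙ rep T k G.∙ g G.⁻¹) · g · a      ∎)
      where open GroupProperties G.group

    trace-of-invariant : ∀ T (x : AbelianGroup.Carrier (fixedPoints A H)) →
                         trace T (proj₁ x) A.≈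
                           proj₁ (RawMonoidOps._×_ (AbelianGroup.rawMonoid (fixedPoints A H))
                                   (size T) x)
    trace-of-invariant T x = begin
      trace T (proj₁ x)          ≈⟨ sum-cong-≋ {size T} (λ k → proj₂ x (rep∈ T k)) ⟩
      sum (λ (_ : Fin (size T)) → proj₁ x)  ≈⟨ fixedPoints-sum H (replicate (size T) x) ⟨
      proj₁ (Aᴴ.sum (replicate (size T) x)) ≈⟨ Aᴴ.sum-replicate (size T) {x} ⟩
      proj₁ (RawMonoidOps._×_ (AbelianGroup.rawMonoid (fixedPoints A H)) (size T) x) ∎
      where
      module Aᴴ = CommutativeMonoidSum (AbelianGroup.commutativeMonoid (fixedPoints A H))

  trace-≃ : ∀ {I H I′ H′ : Subgroup G.group} (S : LeftTransversal I H) (T : LeftTransversal I′ H′) →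
            I ≃ I′ → H ≃ H′ → ∀ {a} → Invariant A I′ a → trace S a A.≈ trace T a
  trace-≃ S T I≃I′ H≃H′ = trace-independent (≃-transversal I≃I′ H≃H′ S) T

  trace-compose : ∀ {J I H : Subgroup G.group} (I≤H : I ≤ H) (J≤I : J ≤ I)
                  (S : LeftTransversal I H) (T : LeftTransversal J I) a →
                  trace S (trace T a) A.≈ trace (compose {J = J} {I} {H} I≤H J≤I S T) a
  trace-compose I≤H J≤I S T a = begin
    sum (λ i → rep S i · sum (λ j → rep T j · a))
      ≈⟨ sum-cong-≋ {size S} (λ i → A.trans (·-sum (rep S i) (orbit T a))
           (sum-cong-≋ {size T} λ j → A.sym (A.·-assoc (rep S i) (rep T j) a))) ⟩
    sum (λ i → sum (λ j → (rep S i G.∙ rep T j) · a))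
      ≈⟨ sum-unflatten (AbelianGroup.commutativeMonoid A.abelianGroup) _
           (λ (i , j) → (rep S i G.∙ rep T j) · a) ⟨
    trace (compose I≤H J≤I S T) a ∎

  trace-composeDouble : ∀ {I H J : Subgroup G.group} (I≤H : I ≤ H) (R : DoubleTransversal I H J) →
    let h = DoubleTransversal.rep R in
    (T : ∀ k → LeftTransversal (I ∩ˢ (h k ▸ J)) I) → ∀ a →
    sum (λ k → trace (T k) (h k · a)) A.≈ trace (composeDouble {I = I} {H} {J} I≤H R T) a
  trace-composeDouble I≤H R T a = begin
    sum (λ k → sum (λ l → rep (T k) l · h k · a))
      ≈⟨ sum-cong-≋ {DoubleTransversal.size R} (λ k → sum-cong-≋ {size (T k)} λ l →
           A.·-assoc (rep (T k) l) (h k) a) ⟨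
    sum (λ k → sum (λ l → (rep (T k) l G.∙ h k) · a))
      ≈⟨ sum-unflatten (AbelianGroup.commutativeMonoid A.abelianGroup) _
           (λ (k , l) → (rep (T k) l G.∙ h k) · a) ⟨
    trace (composeDouble I≤H R T) a ∎
    where h = DoubleTransversal.rep R

  ·-invariant : ∀ g {H a} → Invariant A H a → Invariant A (g ▸ H) (g · a)
  ·-invariant g {a = a} inv {x} (h , h∈H , x≈ghg⁻¹) = begin
    x · g · a                               ≈⟨ A.·-assoc x g a ⟨
    (x G.∙ g) · a                           ≈⟨ A.·-cong (G.∙-congʳ x≈ghg⁻¹) A.refl ⟩
    (g G.∙ h G.∙ g G.⁻¹ G.∙ g) · a          ≈⟨ A.·-cong (//-rightDividesˡ g _) A.refl ⟩
    (g G.∙ h) · a                           ≈⟨ A.·-assoc g h a ⟩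
    g · h · a                               ≈⟨ A.·-cong G.refl (inv h∈H) ⟩
    g · a                                   ∎
    where open GroupProperties G.group

  module _ (S : SubgroupSystem G.group) (fin : IFinite S) where
    open SubgroupSystem S

    H⁰ : RICFunctorOn S (fixedPointFamily A S)
    H⁰ = record
      { res = λ {I} {H} p → additive⇒Hom (fixedPoints A (proj₁ H)) (fixedPoints A (proj₁ I))
          (λ (a , inv) → a , λ h∈I → inv (Sub-≤ 𝐫 (proj₂ H) p h∈I))
          id (λ _ _ → A.refl)
      ; ind = λ {H} {I} p → additive⇒Hom (fixedPoints A (proj₁ I)) (fixedPoints A (proj₁ H))
          (λ (a , inv) → trace (fin {H} {I} p) a , trace-invariant (fin {H} {I} p) inv)
          (trace-cong (fin {H} {I} p)) (λ (a , _) (b , _) → trace-+ (fin {H} {I} p) a b)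
      ; con = λ g H → additive⇒Hom (fixedPoints A (proj₁ H)) (fixedPoints A (g ▸ proj₁ H))
          (λ (a , inv) → g · a , ·-invariant g {proj₁ H} inv)
          (A.·-cong G.refl) (λ (a , _) (b , _) → A.·-distrib-+ g a b)
      ; res-cast = λ _ _ _ _ _ → A.refl
      ; ind-cast = λ {H} {I} {H′} {I′} p p′ d e (a , inv) →
          A.sym (trace-≃ (fin {H} {I} p) (fin {H′} {I′} p′) d e λ h∈I′ → inv (proj₂ d h∈I′))
      ; con-cast = λ _ _ _ → A.refl
      ; con-cong = λ _ e _ → A.·-cong e A.refl
      ; res-id   = λ _ _ → A.refl
      ; ind-id   = λ {H} p (a , inv) → A.trans
          (trace-independent (fin {H} {H} p) (trivialTransversal (proj₁ H)) inv)
          (A.trans (A.identityʳ _) (A.·-identity a))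
      ; con-id   = λ _ (a , _) → A.·-identity a
      ; res-res  = λ _ _ _ _ → A.refl
      ; ind-ind  = λ {H} {I} {J} p q r (a , inv) →
          let I≤H = Sub-≤ 𝐢 (proj₂ H) p
              J≤I = Sub-≤ 𝐢 (proj₂ I) q
              T   = fin {H} {I} p
              T′  = fin {I} {J} q
          in A.trans (trace-compose I≤H J≤I T T′ a)
               (trace-independent (compose I≤H J≤I T T′) (fin {H} {J} r) inv)
      ; con-con  = λ g′ g _ (a , _) → A.sym (A.·-assoc g′ g a)
      ; con-res  = λ _ _ _ → A.refl
      ; con-ind  = λ g {H} {I} p (a , inv) →
          let I≤H = Sub-≤ 𝐢 (proj₂ H) p
              T   = fin {H} {I} p
          in A.trans (trace-conjugate I≤H g T a)
               (trace-independent (conjugate I≤H g T)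
                 (fin {g ▸ᵐ H} {g ▸ᵐ I} (∈-▸ g {I} {H} p)) (·-invariant g {proj₁ I} inv))
      }

    H⁰-isH⁰ : IsH⁰ A H⁰
    H⁰-isH⁰ = record
      { res-inclusion   = λ _ _ → A.refl
      ; ind-transversal = λ {H} {I} p T (_ , inv) → trace-independent (fin {H} {I} p) T inv
      ; con-action      = λ _ _ _ → A.refl
      }

    H⁰-cohomological : Cohomological H⁰
    H⁰-cohomological = record
      { finiteIndex = λ {H} {I} _ q → fin {H} {I} q
      ; ind-res     = λ {H} {I} p q T (a , inv) → A.trans
          (trace-independent (fin {H} {I} q) T λ h∈I → inv (Sub-≤ 𝐫 (proj₂ H) p h∈I))
          (trace-of-invariant T (a , inv))
      }

    H⁰-stable : Stable H⁰
    H⁰-stable _ h∈H (_ , inv) = inv h∈H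

    H⁰-mackey : (M : IsMackeySystem S) → IsMackeyFunctor H⁰ M
    H⁰-mackey M = record
      { stable = H⁰-stable
      ; mackey = λ {H} {I} {J} p q R (a , inv) →
          let open DoubleTransversal R using () renaming (size to n; rep to h; rep∈ to h∈)
              I≤H = Sub-≤ 𝐫 (proj₂ H) p
              T   = λ k → fin {I} {∩▸ {H} {I} {J} (h∈ k) p q} (∩▸∈ⁱ {H} {I} {J} (h∈ k) p q)
          in begin
            trace (fin {H} {J} q) a
              ≈⟨ trace-independent (fin {H} {J} q) (composeDouble I≤H R T) inv ⟩
            trace (composeDouble I≤H R T) a
              ≈⟨ trace-composeDouble I≤H R T a ⟨
            sum (λ k → trace (T k) (h k · a))
              ≈⟨ fixedPoints-sum (proj₁ I) {n} _ ⟨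
            _ ∎
      }
      where open IsMackeySystem M

proposition2p3p4 :
    ∀ {u} (G : TopologicalGroup u) (A : DiscreteModule G)
    (S : SubgroupSystem (TopologicalGroup.group G)) → IFinite S →
    Σ[ F ∈ RICFunctorOn S (fixedPointFamily A S) ]
      IsH⁰ A F × Cohomological F × Stable F ×
      ((M : IsMackeySystem S) → IsMackeyFunctor F M)
proposition2p3p4 G A S fin =
  H⁰ A S (λ {H} {I} → fin {H} {I}) , H⁰-isH⁰ A S fin , H⁰-cohomological A S fin ,
  H⁰-stable A S (λ {H} {I} → fin {H} {I}) , H⁰-mackey A S fin
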